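{- The function $$(1^n\,0\,1^{a_1}\,0\,\dots\,0\,1^{a_k})\ \mapsto\ \binom{n}{a_1,\ldots,a_k}$$ is in $\#\mathsf{L}$. Here $k$ is not assumed to be fixed.
   Context: $\binom{n}{a_1,\dots,a_k}=\frac{n!}{a_1!\cdots a_k!}$ is the multinomial coefficient, for non-negative integers $a_1,\dots,a_k$ with $a_1+\dots+a_k=n$. The alphabet is $\Sigma=\{0,1\}$; $1^a$ is the string of $a$ ones and juxtaposition is concatenation. A function given only on strings of a displayed form is extended by $0$ to all other strings. $\#\mathsf{L}$ is the class of functions $f:\Sigma^*\to\mathbb{N}_0$ such that $f(x)$ is the number of accepting computation paths on input $x$ of a fixed nondeterministic Turing machine with read-only input tape that uses $O(\log|x|)$ work space and halts on every computation path. Equivalently: there are a polynomial $q$ and a deterministic $O(\log|x|)$-space Turing machine $M$ with an additional read-once, left-to-right witness tape such that $f(x)=\#\{w\in\Sigma^{q(|x|)}\mid M(x,w)=\mathsf{yes}\}$. -}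

module Defs where

open import Data.Bool.Base using (Bool; true; false; T; if_then_else_)
open import Data.Bool.Properties using (if-cong)
open import Data.Fin.Base using (Fin)
open import Data.List.Base using (List; []; _∷_; _++_; length; map; replicate; concatMap)
open import Data.List.Membership.Propositional using (_∈_)
open import Data.List.Relation.Unary.All.Properties using (map⁺)
import Data.List.Relation.Unary.All as All
open import Data.List.Relation.Unary.Unique.Propositional using (Unique)
open import Data.Nat.Base using (ℕ; zero; suc; pred; _+_; _*_; _⊓_; _≤_; _/_; _!; NonZero)
open import Data.Nat.ListAction using (sum; product)
open import Data.Nat.ListAction.Properties using (product≢0)
open import Data.Nat.Logarithm using (⌊log₂_⌋)
open import Data.Nat.Properties using (_≟_; _!≢0)
open import Data.Product.Base using (Σ; ∃-syntax; _×_; _,_; proj₁; proj₂; map₁)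
open import Data.Vec.Base as Vec using (Vec)
open import Function.Base using (flip)
open import Function.Bundles using (_↔_)
open import Induction.WellFounded using (Acc)
open import Relation.Binary.Construct.Closure.ReflexiveTransitive using (Star)
open import Relation.Binary.PropositionalEquality
  using (_≡_; _≢_; refl; sym; trans; cong)
open import Relation.Nullary.Decidable using (does; dec-true; dec-false)

Finite : Set → Set
Finite A = ∃[ n ] (A ↔ Fin n)

data Dir : Set where
  left stay right : Dir

data InputCell : Set where
  leftEnd rightEnd : InputCell
  bit              : Bool → InputCell

record Move (Q Γ : Set) (k : ℕ) : Set where
  constructor move
  field
    next     : Q
    inputDir : Dir
    work     : Vec (Γ × Dir) k

-- The transition set of a local situation is given as a duplicate-free list.
record NTM : Set₁ where
  field
    State         : Set
    Symbol        : Set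
    finite-State  : Finite State
    finite-Symbol : Finite Symbol
    tapes         : ℕ
    start         : State
    accepting     : State → Bool
    blank         : Symbol
    δ             : State → InputCell → Vec Symbol tapes → List (Move State Symbol tapes)
    δ-unique      : ∀ q a w → Unique (δ q a w)

-- The visited part of a two-way infinite tape; `before` is listed from the
-- scanned cell leftwards, `after` from the scanned cell rightwards.  Every cell
-- outside this part is still blank.
record Tape (Γ : Set) : Set where
  constructor tape
  field
    before  : List Γ
    scanned : Γ
    after   : List Γ

module _ {Γ : Set} where

  size : Tape Γ → ℕ
  size (tape ls _ rs) = suc (length ls + length rs)

  shift : Γ → Dir → Tape Γ → Tape Γ
  shift b left  (tape []       s rs)       = tape [] b (s ∷ rs)
  shift b left  (tape (l ∷ ls) s rs)       = tape ls l (s ∷ rs)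
  shift b stay  t                          = t
  shift b right (tape ls       s [])       = tape (s ∷ ls) b []
  shift b right (tape ls       s (r ∷ rs)) = tape (s ∷ ls) r rs

  writeShift : Γ → Γ × Dir → Tape Γ → Tape Γ
  writeShift b (s , d) (tape ls _ rs) = shift b d (tape ls s rs)

-- Input position 0 holds the left end marker, positions 1 … |x| hold x, and
-- position |x| + 1 holds the right end marker.
readInput : List Bool → ℕ → InputCell
readInput x       zero          = leftEnd
readInput []      (suc _)       = rightEnd
readInput (b ∷ x) (suc zero)    = bit b
readInput (b ∷ x) (suc (suc i)) = readInput x (suc i)

-- The head cannot leave the interval from 0 to |x| + 1.
moveInput : List Bool → Dir → ℕ → ℕ
moveInput x left  i = pred i
moveInput x stay  i = i
moveInput x right i = suc i ⊓ suc (length x)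

module Run (M : NTM) (x : List Bool) where
  open NTM M

  record Config : Set where
    constructor config
    field
      state     : State
      inputHead : ℕ
      workTapes : Vec (Tape Symbol) tapes
  open Config public

  initial : Config
  initial = config start 0 (Vec.replicate tapes (tape [] blank []))

  moves : Config → List (Move State Symbol tapes)
  moves (config q i ts) = δ q (readInput x i) (Vec.map Tape.scanned ts)

  apply : Move State Symbol tapes → Config → Config
  apply (move q d ws) (config _ i ts) =
    config q (moveInput x d i) (Vec.zipWith (writeShift blank) ws ts)

  -- Proof-relevant: a step records which transition was chosen, so that an
  -- element of Star _⟶_ C D is a computation path from C to D.
  _⟶_ : Config → Config → Set
  C ⟶ D = ∃[ m ] (m ∈ moves C × D ≡ apply m C)

  Halted : Config → Set
  Halted C = moves C ≡ []

  AcceptingPath : Set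
  AcceptingPath = ∃[ C ] (Star _⟶_ initial C × Halted C × T (accepting (state C)))

  -- Well-foundedness of the step relation below the initial configuration:
  -- there is no infinite computation path.
  HaltsOnEveryPath : Set
  HaltsOnEveryPath = Acc (flip _⟶_) initial

  -- The number of work tape cells visited so far.
  space : Config → ℕ
  space C = Vec.sum (Vec.map size (workTapes C))

LogSpace : NTM → Set
LogSpace M = ∃[ c ] ∃[ n₀ ] ∀ x → n₀ ≤ length x →
  let open Run M x in
  ∀ C → Star _⟶_ initial C → space C ≤ c * ⌊log₂ length x ⌋

infix 4 _∈#L

_∈#L : (List Bool → ℕ) → Set₁
f ∈#L = Σ NTM λ M →
  (∀ x → Run.HaltsOnEveryPath M x) ×
  LogSpace M ×
  (∀ x → Run.AcceptingPath M x ↔ Fin (f x))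

private
  factorials≢0 : ∀ as → NonZero (product (map _! as))
  factorials≢0 as = product≢0 (map⁺ (All.universal _!≢0 as))

-- n! / (a₁! ⋯ aₖ!); only meaningful when sum as ≡ n, in which case the natural
-- number division is exact.
multinomial : ℕ → List ℕ → ℕ
multinomial n as = _/_ (n !) (product (map _! as)) {{factorials≢0 as}}

-- The symbols 1 and 0 are true and false:  1ⁿ 0 1^a₁ 0 ⋯ 0 1^aₖ.
encode : ℕ → List ℕ → List Bool
encode n as = replicate n true ++ concatMap (λ a → false ∷ replicate a true) as

-- The inverse of encode (see encode-decode and decode-encode).
decode : List Bool → ℕ × List ℕ
decode []          = 0 , []
decode (true  ∷ x) = map₁ suc (decode x)
decode (false ∷ x) = 0 , proj₁ (decode x) ∷ proj₂ (decode x)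

-- Displayed strings have k ≥ 1, so a string without a 0 gets the value 0, as
-- does every string whose a₁, …, aₖ do not sum to n.
multinomialValue : ℕ × List ℕ → ℕ
multinomialValue (n , [])     = 0
multinomialValue (n , a ∷ as) =
  if does (sum (a ∷ as) ≟ n) then multinomial n (a ∷ as) else 0

multinomialFunction : List Bool → ℕ
multinomialFunction x = multinomialValue (decode x)

decode-encode : ∀ n as → decode (encode n as) ≡ (n , as)
decode-encode zero    []       = refl
decode-encode zero    (a ∷ as) =
  cong (λ p → 0 , proj₁ p ∷ proj₂ p) (decode-encode a as)
decode-encode (suc n) as       = cong (map₁ suc) (decode-encode n as)

encode-decode : ∀ x → encode (proj₁ (decode x)) (proj₂ (decode x)) ≡ x
encode-decode []          = refl
encode-decode (true  ∷ x) = cong (true ∷_) (encode-decode x)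
encode-decode (false ∷ x) = cong (false ∷_) (encode-decode x)

-- These two facts determine multinomialFunction.
multinomialFunction-encode : ∀ n a as → sum (a ∷ as) ≡ n →
  multinomialFunction (encode n (a ∷ as)) ≡ multinomial n (a ∷ as)
multinomialFunction-encode n a as eq =
  trans (cong multinomialValue (decode-encode n (a ∷ as)))
        (if-cong (dec-true (sum (a ∷ as) ≟ n) eq))

multinomialFunction-elsewhere : ∀ x →
  (∀ n a as → sum (a ∷ as) ≡ n → x ≢ encode n (a ∷ as)) →
  multinomialFunction x ≡ 0
multinomialFunction-elsewhere x notDisplayed with decode x | encode-decode x
... | n , []     | _  = refl
... | n , a ∷ as | eq =
  if-cong (dec-false (sum (a ∷ as) ≟ n) λ s → notDisplayed n a as s (sym eq))

{-# OPTIONS --safe #-}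
module Submission where

-- A block a of the input is answered by a binomial coefficient: if r objects
-- remain after the earlier blocks, there are (r choose a) ways to select the
-- a objects of this block, and the product of these numbers over all blocks
-- is the multinomial coefficient when the blocks sum to n.  The machine reads
-- its input once, from left to right, and makes these selections object by
-- object, keeping two numbers c and d:
--
--   * c is the number of objects still to be decided on in the current block,
--   * d is the number of objects already passed on to the later blocks.
--
-- Reading the prefix of n ones adds 1 to d for each of them, and each symbol 0
-- requires c = 0 and exchanges c and d, so the first block starts with c = n.
-- Within a block the machine chooses nondeterministically: either it selects
-- the next object (c decreases, the head moves past a 1), or it passes the
-- object on (c decreases, d increases, the head stays).  At the end of the
-- input it accepts if and only if c = d = 0.  A 1 that is met with c = 0, and
-- an exchange with c > 0, lead to rejection.  The number of accepting paths
-- satisfies a recurrence (the function ways) which Pascal's rule solves in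
-- ways-blockwise; total≡multinomialValue turns the solution into factorials.
--
-- The numbers c and d are stored in binary on one work tape whose cells hold a
-- bit of each, least significant bit first.  Every arithmetic operation is one
-- sweep over the cells away from the resting cell, followed by the return.
-- Both numbers stay at most |x|, and a new cell is only needed when d becomes
-- a power of two, so about log |x| cells suffice.
--
-- The three requirements (halting, space, number of accepting paths) are
-- proved together.  A Tree is a finite computation tree, indexed by its number
-- of accepting leaves, in which every configuration obeys the space bound;
-- tree-acc, tree-space and tree-count extract the three facts.  A tree for the
-- initial configuration is assembled backwards, each operation of the machine
-- turning a tree for its outcome into a tree for its start.

open import Axiom.UniquenessOfIdentityProofs.WithK using (uip)
open import Data.Bool.Base using (Bool; true; false; not; _∧_; _xor_; if_then_else_; T)
open import Data.Bool.Properties using (T-irrelevant; if-cong)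
open import Data.Empty using (⊥-elim)
open import Data.Fin.Base using (Fin) renaming (zero to fzero; suc to fsuc)
open import Data.Fin.Properties using (0↔⊥; 1↔⊤; 2↔Bool; +↔⊎; *↔×)
open import Data.List.Base using (List; []; _∷_; [_]; _++_; _ʳ++_; length; map; drop; fromMaybe)
open import Data.List.Membership.Propositional using (_∈_)
open import Data.List.Relation.Unary.All using ([]; _∷_)
open import Data.List.Relation.Unary.AllPairs using ([]; _∷_)
open import Data.List.Relation.Unary.Any using (here; there)
open import Data.List.Relation.Unary.Unique.Propositional using (Unique)
open import Data.Maybe.Base using (Maybe; just; nothing)
open import Data.Nat.Base
  using (ℕ; zero; suc; _+_; _*_; _∸_; _^_; _/_; _!; _≤_; z≤n; s≤s; NonZero)
open import Data.Nat.Combinatorics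
  using (nCk≡n!/k![n-k]!; k>n⇒nCk≡0; k![n∸k]!∣n!; nCk+nC[k+1]≡[n+1]C[k+1])
  renaming (_C_ to _choose_)
open import Data.Nat.DivMod using (m/n*n≡m; m*n/n≡m)
open import Data.Nat.ListAction using (sum; product)
open import Data.Nat.Logarithm using (⌊log₂_⌋; ⌊log₂⌋-mono-≤; ⌊log₂[2^n]⌋≡n)
open import Data.Nat.Properties
open import Data.Nat.Tactic.RingSolver using (solve-∀)
open import Data.Product.Base using (∃-syntax; _×_; _,_; proj₁; proj₂)
open import Data.Product.Function.NonDependent.Propositional using (_×-↔_)
open import Data.Sum.Base using (_⊎_; inj₁; inj₂)
open import Data.Sum.Function.Propositional using (_⊎-↔_)
open import Data.Vec.Base using (Vec; []; _∷_)
open import Function.Base using (flip; _∘_)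
open import Function.Bundles using (_↔_; mk↔ₛ′)
open import Function.Properties.Inverse using (↔-refl; ↔-sym; ↔-trans)
open import Induction.WellFounded using (Acc; acc)
open import Relation.Binary.Construct.Closure.ReflexiveTransitive using (Star; ε; _◅_)
open import Relation.Binary.PropositionalEquality
  using (_≡_; _≢_; refl; sym; trans; cong; cong₂; subst; module ≡-Reasoning)
open import Relation.Nullary using (¬_; yes; no)
open import Relation.Nullary.Decidable using (dec-true; dec-false)

open import Defs

-- Computation trees of an arbitrary machine

∉[] : ∀ {A : Set} {a : A} {as} → as ≡ [] → ¬ (a ∈ as)
∉[] refl ()

∷≢[] : ∀ {A : Set} {a : A} {as : List A} → a ∷ as ≢ []
∷≢[] ()

-- Tree C k is the computation tree of configuration C, with k accepting leaves
-- and at most S visited work cells in every configuration.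
module ComputationTree (M : NTM) (x : List Bool) (S : ℕ) where
  open NTM M
  open Run M x

  mutual

    data Tree (C : Config) : ℕ → Set where
      leaf : space C ≤ S → Halted C → Tree C (if accepting (state C) then 1 else 0)
      node : ∀ {k} → space C ≤ S → ¬ Halted C → Branches C (moves C) k → Tree C k

    -- The trees below C for the transitions in the given list.
    data Branches (C : Config) : List (Move State Symbol tapes) → ℕ → Set where
      []  : Branches C [] 0
      _∷_ : ∀ {m ms j k} → Tree (apply m C) j → Branches C ms k → Branches C (m ∷ ms) (j + k)

  dead-end : ∀ {C} → space C ≤ S → Halted C → accepting (state C) ≡ false → Tree C 0
  dead-end {C} sp h eq = subst (λ b → Tree C (if b then 1 else 0)) eq (leaf sp h)

  -- A deterministic step.
  one : ∀ {C m D k} → space C ≤ S → moves C ≡ [ m ] → apply m C ≡ D → Tree D k → Tree C k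
  one {C} {k = k} sp eq refl t =
    node sp (∷≢[] ∘ trans (sym eq))
      (subst (λ ms → Branches C ms k) (sym eq)
        (subst (Branches C _) (+-identityʳ k) (t ∷ [])))

  -- A binary choice.
  two : ∀ {C m m′ D D′ j k} → space C ≤ S → moves C ≡ m ∷ m′ ∷ [] →
        apply m C ≡ D → apply m′ C ≡ D′ → Tree D j → Tree D′ k → Tree C (j + k)
  two {C} {j = j} {k} sp eq refl refl t t′ =
    node sp (∷≢[] ∘ trans (sym eq))
      (subst (λ ms → Branches C ms (j + k)) (sym eq)
        (t ∷ subst (Branches C _) (+-identityʳ k) (t′ ∷ [])))

  mutual

    tree-acc : ∀ {C k} → Tree C k → Acc (flip _⟶_) C
    tree-acc (leaf _ h)    = acc λ { (_ , m∈ , refl) → ⊥-elim (∉[] h m∈) }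
    tree-acc (node _ _ bs) = acc λ { (_ , m∈ , refl) → branch-acc bs m∈ }

    branch-acc : ∀ {C ms m k} → Branches C ms k → m ∈ ms → Acc (flip _⟶_) (apply m C)
    branch-acc (t ∷ _)  (here refl) = tree-acc t
    branch-acc (_ ∷ bs) (there m∈)  = branch-acc bs m∈

  tree-root : ∀ {C k} → Tree C k → space C ≤ S
  tree-root (leaf sp _)   = sp
  tree-root (node sp _ _) = sp

  mutual

    tree-space : ∀ {C D k} → Tree C k → Star _⟶_ C D → space D ≤ S
    tree-space t             ε                     = tree-root t
    tree-space (leaf _ h)    ((_ , m∈ , _) ◅ _)    = ⊥-elim (∉[] h m∈)
    tree-space (node _ _ bs) ((_ , m∈ , refl) ◅ p) = branch-space bs m∈ p

    branch-space : ∀ {C D ms m k} → Branches C ms k → m ∈ ms → Star _⟶_ (apply m C) D → space D ≤ S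
    branch-space (t ∷ _)  (here refl) p = tree-space t p
    branch-space (_ ∷ bs) (there m∈)  p = branch-space bs m∈ p

  -- Accepting computation paths starting at C; PathFrom initial is
  -- AcceptingPath.
  PathFrom : Config → Set
  PathFrom C = ∃[ D ] (Star _⟶_ C D × Halted D × T (accepting (state D)))

  -- Those whose first transition belongs to the given list.
  PathVia : Config → List (Move State Symbol tapes) → Set
  PathVia C ms = ∃[ m ] (m ∈ ms × PathFrom (apply m C))

  pathFrom-halted : ∀ {C} → Halted C → PathFrom C ↔ T (accepting (state C))
  pathFrom-halted {C} h = mk↔ₛ′ to from (λ _ → T-irrelevant _ _) from-to
    where
    to : PathFrom C → T (accepting (state C))
    to (_ , ε , _ , a)                = a
    to (_ , (_ , m∈ , _) ◅ _ , _ , _) = ⊥-elim (∉[] h m∈)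
    from : T (accepting (state C)) → PathFrom C
    from a = C , ε , h , a
    from-to : ∀ p → from (to p) ≡ p
    from-to (_ , ε , h′ , a)               = cong (λ e → C , ε , e , a) (uip h h′)
    from-to (_ , (_ , m∈ , _) ◅ _ , _ , _) = ⊥-elim (∉[] h m∈)

  pathFrom-step : ∀ {C} → ¬ Halted C → PathFrom C ↔ PathVia C (moves C)
  pathFrom-step {C} ¬h = mk↔ₛ′ to from (λ _ → refl) from-to
    where
    to : PathFrom C → PathVia C (moves C)
    to (_ , ε , h , _)                     = ⊥-elim (¬h h)
    to (D , (m , m∈ , refl) ◅ p , h , a) = m , m∈ , D , p , h , a
    from : PathVia C (moves C) → PathFrom C
    from (m , m∈ , D , p , h , a) = D , (m , m∈ , refl) ◅ p , h , a
    from-to : ∀ p → from (to p) ≡ p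
    from-to (_ , ε , h , _)                = ⊥-elim (¬h h)
    from-to (_ , (_ , _ , refl) ◅ _ , _ , _) = refl

  pathVia-[] : ∀ {C} → PathVia C [] ↔ Fin 0
  pathVia-[] = mk↔ₛ′ (λ { (_ , () , _) }) (λ ()) (λ ()) (λ { (_ , () , _) })

  pathVia-∷ : ∀ {C m ms} → PathVia C (m ∷ ms) ↔ (PathFrom (apply m C) ⊎ PathVia C ms)
  pathVia-∷ = mk↔ₛ′
    (λ { (_ , here refl , p) → inj₁ p ; (m , there m∈ , p) → inj₂ (m , m∈ , p) })
    (λ { (inj₁ p) → _ , here refl , p ; (inj₂ (m , m∈ , p)) → m , there m∈ , p })
    (λ { (inj₁ _) → refl ; (inj₂ _) → refl })
    (λ { (_ , here refl , _) → refl ; (_ , there _ , _) → refl })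

  T↔Fin : ∀ b → T b ↔ Fin (if b then 1 else 0)
  T↔Fin true  = ↔-sym 1↔⊤
  T↔Fin false = ↔-sym 0↔⊥

  mutual

    tree-count : ∀ {C k} → Tree C k → PathFrom C ↔ Fin k
    tree-count {C} (leaf _ h)     = ↔-trans (pathFrom-halted {C} h) (T↔Fin _)
    tree-count {C} (node _ ¬h bs) = ↔-trans (pathFrom-step {C} ¬h) (branch-count bs)

    branch-count : ∀ {C ms k} → Branches C ms k → PathVia C ms ↔ Fin k
    branch-count {C} []       = pathVia-[] {C}
    branch-count {C} (t ∷ bs) =
      ↔-trans (pathVia-∷ {C}) (↔-trans (tree-count t ⊎-↔ branch-count bs) (↔-sym +↔⊎))

-- The number of accepting paths

-- 1 at zero, and 0 elsewhere.
isZero : ℕ → ℕ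
isZero zero    = 1
isZero (suc _) = 0

-- The number of accepting paths when y is the unread input, c objects are
-- undecided in the current block and d objects have been passed on.
ways : List Bool → ℕ → ℕ → ℕ
ways []          c       d = isZero (c + d)
ways (false ∷ y) zero    d = ways y d 0
ways (false ∷ y) (suc c) d = ways (false ∷ y) c (suc d)
ways (true  ∷ y) zero    d = 0
ways (true  ∷ y) (suc c) d = ways y c d + ways (true ∷ y) c (suc d)

-- The same while the leading ones are read, when d of them have been counted.
-- Without any 0 the input is rejected.
total : List Bool → ℕ → ℕ
total []          d = 0
total (true  ∷ y) d = total y (suc d)
total (false ∷ y) d = ways y d 0

-- The number of ways to distribute all of r distinct objects over blocks of the given sizes.
distributions : ℕ → List ℕ → ℕ
distributions r []       = isZero r
distributions r (a ∷ as) = (r choose a) * distributions (r ∸ a) as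

-- The value of ways in closed form: the block being read still lacks a objects,
-- and the objects left over from it go to the remaining blocks as.
blockwise : ℕ → ℕ → ℕ × List ℕ → ℕ
blockwise c d (a , as) = (c choose a) * distributions (d + (c ∸ a)) as

-- In the only nontrivial case, selecting or passing on the next object gives the
-- two summands of Pascal's rule.
ways-blockwise : ∀ y c d → ways y c d ≡ blockwise c d (decode y)
ways-blockwise [] c d = trans (cong isZero (+-comm c d)) (sym (*-identityˡ _))
ways-blockwise (false ∷ y) zero d = begin
  ways y d 0                               ≡⟨ ways-blockwise y d 0 ⟩
  distributions d as                       ≡⟨ cong (λ r → distributions r as) (+-identityʳ d) ⟨
  distributions (d + 0) as                 ≡⟨ *-identityˡ _ ⟨
  1 * distributions (d + 0) as             ∎
  where open ≡-Reasoning
        as = proj₁ (decode y) ∷ proj₂ (decode y)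
ways-blockwise (false ∷ y) (suc c) d = begin
  ways (false ∷ y) c (suc d)               ≡⟨ ways-blockwise (false ∷ y) c (suc d) ⟩
  1 * distributions (suc (d + c)) as       ≡⟨ cong (λ r → 1 * distributions r as) (+-suc d c) ⟨
  1 * distributions (d + suc c) as         ∎
  where open ≡-Reasoning
        as = proj₁ (decode y) ∷ proj₂ (decode y)
ways-blockwise (true ∷ y) zero    d = refl
ways-blockwise (true ∷ y) (suc c) d = begin
  ways y c d + ways (true ∷ y) c (suc d)
    ≡⟨ cong₂ _+_ (ways-blockwise y c d) (ways-blockwise (true ∷ y) c (suc d)) ⟩
  (c choose a) * w + (c choose suc a) * distributions (suc d + (c ∸ suc a)) as
    ≡⟨ cong ((c choose a) * w +_) same-remainder ⟩
  (c choose a) * w + (c choose suc a) * w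
    ≡⟨ *-distribʳ-+ w (c choose a) (c choose suc a) ⟨
  (c choose a + c choose suc a) * w
    ≡⟨ cong (_* w) (nCk+nC[k+1]≡[n+1]C[k+1] c a) ⟩
  (suc c choose suc a) * w ∎
  where
  open ≡-Reasoning
  a = proj₁ (decode y)
  as = proj₂ (decode y)
  w = distributions (d + (c ∸ a)) as
  -- For c < a + 1 the truncated subtractions disagree, but the binomial
  -- coefficient vanishes.
  same-remainder :
    (c choose suc a) * distributions (suc d + (c ∸ suc a)) as ≡ (c choose suc a) * w
  same-remainder with suc a ≤? c
  ... | yes a<c = cong (λ r → (c choose suc a) * distributions r as)
                    (trans (sym (+-suc d _)) (cong (d +_) (sym (+-∸-assoc 1 a<c))))
  ... | no  a≮c rewrite k>n⇒nCk≡0 (≰⇒> a≮c) = refl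

nCk*k![n∸k]!≡n! : ∀ {n k} → k ≤ n → (n choose k) * (k ! * (n ∸ k) !) ≡ n !
nCk*k![n∸k]!≡n! {n} {k} k≤n =
  trans (cong (_* (k ! * (n ∸ k) !)) (nCk≡n!/k![n-k]! k≤n)) (m/n*n≡m (k![n∸k]!∣n! k≤n))
  where instance _ = k !* (n ∸ k) !≢0

distributions-sum : ∀ as → distributions (sum as) as * product (map _! as) ≡ sum as !
distributions-sum []       = refl
distributions-sum (a ∷ as) = begin
  ((a + s) choose a) * distributions (a + s ∸ a) as * (a ! * p)
    ≡⟨ cong (λ r → ((a + s) choose a) * distributions r as * (a ! * p)) (m+n∸m≡n a s) ⟩
  ((a + s) choose a) * distributions s as * (a ! * p)
    ≡⟨ regroup ((a + s) choose a) (distributions s as) (a !) p ⟩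
  ((a + s) choose a) * (a ! * (distributions s as * p))
    ≡⟨ cong (λ q → ((a + s) choose a) * (a ! * q)) (distributions-sum as) ⟩
  ((a + s) choose a) * (a ! * s !)
    ≡⟨ cong (λ r → ((a + s) choose a) * (a ! * r !)) (m+n∸m≡n a s) ⟨
  ((a + s) choose a) * (a ! * (a + s ∸ a) !)
    ≡⟨ nCk*k![n∸k]!≡n! (m≤m+n a s) ⟩
  (a + s) ! ∎
  where
  open ≡-Reasoning
  s = sum as
  p = product (map _! as)
  regroup : ∀ b w f q → b * w * (f * q) ≡ b * (f * (w * q))
  regroup = solve-∀

distributions-≢ : ∀ r as → sum as ≢ r → distributions r as ≡ 0
distributions-≢ zero    []       s≢r = ⊥-elim (s≢r refl)
distributions-≢ (suc r) []       s≢r = refl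
distributions-≢ r       (a ∷ as) s≢r with a ≤? r
... | yes a≤r = trans (cong ((r choose a) *_) (distributions-≢ (r ∸ a) as s≢r∸a)) (*-zeroʳ (r choose a))
  where
  s≢r∸a : sum as ≢ r ∸ a
  s≢r∸a eq = s≢r (trans (cong (a +_) eq) (m+[n∸m]≡n a≤r))
... | no  a≰r = cong (_* distributions (r ∸ a) as) (k>n⇒nCk≡0 (≰⇒> a≰r))

factorials-nonZero : ∀ as → NonZero (product (map _! as))
factorials-nonZero []       = _
factorials-nonZero (a ∷ as) = m*n≢0 (a !) _ {{a !≢0}} {{factorials-nonZero as}}

distributions≡multinomial : ∀ as → distributions (sum as) as ≡ multinomial (sum as) as
distributions≡multinomial as = begin
  distributions (sum as) as                                 ≡⟨ m*n/n≡m _ (product (map _! as)) ⟨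
  distributions (sum as) as * product (map _! as) / product (map _! as)
                            ≡⟨ cong (_/ product (map _! as)) (distributions-sum as) ⟩
  multinomial (sum as) as ∎
  where
  open ≡-Reasoning
  instance _ = factorials-nonZero as

distributions≡multinomialValue : ∀ r a as →
  distributions r (a ∷ as) ≡ multinomialValue (r , a ∷ as)
distributions≡multinomialValue r a as with sum (a ∷ as) ≟ r
... | yes refl = trans (distributions≡multinomial (a ∷ as))
                       (sym (if-cong (dec-true (sum (a ∷ as) ≟ r) refl)))
... | no  s≢r  = trans (distributions-≢ r (a ∷ as) s≢r)
                       (sym (if-cong (dec-false (sum (a ∷ as) ≟ r) s≢r)))

total≡multinomialValue : ∀ y d →
  total y d ≡ multinomialValue (d + proj₁ (decode y) , proj₂ (decode y))
total≡multinomialValue []          d = refl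
total≡multinomialValue (true ∷ y)  d = trans (total≡multinomialValue y (suc d))
  (cong (λ r → multinomialValue (r , proj₂ (decode y))) (sym (+-suc d _)))
total≡multinomialValue (false ∷ y) d = begin
  ways y d 0                       ≡⟨ ways-blockwise y d 0 ⟩
  distributions d (a ∷ as)         ≡⟨ distributions≡multinomialValue d a as ⟩
  multinomialValue (d , a ∷ as)    ≡⟨ cong (λ r → multinomialValue (r , a ∷ as)) (+-identityʳ d) ⟨
  multinomialValue (d + 0 , a ∷ as) ∎
  where
  open ≡-Reasoning
  a = proj₁ (decode y)
  as = proj₂ (decode y)

-- The machine

-- Whether the leading ones are being read, or a later block.
Phase : Set
Phase = Bool

pattern loading  = false
pattern choosing = true

-- One bit of c and the bit of d of the same weight.
Digit : Set
Digit = Bool × Bool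

-- The blank is nothing.
Symbol : Set
Symbol = Maybe Digit

-- In state idle the work head is on the resting cell, which is always blank and
-- lies directly to the left of the digits; only there is the input consulted.
-- The states add, swap and verify sweep to the right over the digits:
-- add β κ subtracts the borrow β from c and adds the carry κ to d, swap
-- exchanges c = 0 with d, and verify checks that c = d = 0.  In state back the
-- head returns to the resting cell.
data State : Set where
  idle   : Phase → State
  add    : (borrow carry : Bool) → Phase → State
  back   : Phase → State
  swap   : State
  verify : State
  accept : State

Instruction : Set
Instruction = Move State Symbol 1

-- Leave the resting cell for a sweep.
launch : State → Dir → Instruction
launch q d = move q d ((nothing , right) ∷ [])

-- The left end marker is only scanned at the very beginning.
choices : Phase → InputCell → List Instruction
choices f        leftEnd     = [ move (idle f) right ((nothing , stay) ∷ []) ]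
choices loading  (bit true)  = [ launch (add false true loading) right ]
choices loading  (bit false) = [ launch swap right ]
choices loading  rightEnd    = []
choices choosing (bit true)  =
  launch (add true false choosing) right ∷ launch (add true true choosing) stay ∷ []
choices choosing (bit false) =
  launch swap right ∷ launch (add true true choosing) stay ∷ []
choices choosing rightEnd    = [ launch verify stay ]

write : State → Symbol → Dir → Maybe Instruction
write q s d = just (move q stay ((s , d) ∷ []))

-- The deterministic transitions.  A borrow left over at the end of the digits
-- means that c was 0, and the path dies; a left over carry extends the digits.
sweep : State → Symbol → Maybe Instruction
sweep (idle f)             _                    = nothing
sweep (add β κ f)          (just (x , y))       = write (add (β ∧ not x) (κ ∧ y) f) (just (β xor x , κ xor y)) right
sweep (add true  κ     f)  nothing              = nothing
sweep (add false true  f)  nothing              = write (add false false f) (just (false , true)) right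
sweep (add false false f)  nothing              = write (back f) nothing left
sweep (back f)             (just d)             = write (back f) (just d) left
sweep (back f)             nothing              = write (idle f) nothing stay
sweep swap                 (just (false , y))   = write swap (just (y , false)) right
sweep swap                 (just (true  , y))   = nothing
sweep swap                 nothing              = write (back choosing) nothing left
sweep verify               (just (false , false)) = write verify (just (false , false)) right
sweep verify               (just (false , true )) = nothing
sweep verify               (just (true  , _ ))  = nothing
sweep verify               nothing              = write accept nothing stay
sweep accept               _                    = nothing

transitions : State → InputCell → Vec Symbol 1 → List Instruction
transitions (idle f) a _       = choices f a
transitions q        _ (s ∷ []) = fromMaybe (sweep q s)

isAccept : State → Bool
isAccept accept = true
isAccept _      = false

choices-unique : ∀ f a → Unique (choices f a)
choices-unique f        leftEnd     = [] ∷ []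
choices-unique loading  (bit true)  = [] ∷ []
choices-unique loading  (bit false) = [] ∷ []
choices-unique loading  rightEnd    = []
choices-unique choosing (bit true)  = ((λ ()) ∷ []) ∷ [] ∷ []
choices-unique choosing (bit false) = ((λ ()) ∷ []) ∷ [] ∷ []
choices-unique choosing rightEnd    = [] ∷ []

fromMaybe-unique : ∀ {A : Set} (m : Maybe A) → Unique (fromMaybe m)
fromMaybe-unique (just _) = [] ∷ []
fromMaybe-unique nothing  = []

transitions-unique : ∀ q a w → Unique (transitions q a w)
transitions-unique (idle f)       a _        = choices-unique f a
transitions-unique q@(add _ _ _)  _ (s ∷ []) = fromMaybe-unique (sweep q s)
transitions-unique q@(back _)     _ (s ∷ []) = fromMaybe-unique (sweep q s)
transitions-unique swap           _ (s ∷ []) = fromMaybe-unique (sweep swap s)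
transitions-unique verify         _ (s ∷ []) = fromMaybe-unique (sweep verify s)
transitions-unique accept         _ (s ∷ []) = []

finite-↔ : ∀ {A B} → A ↔ B → Finite B → Finite A
finite-↔ f (n , g) = n , ↔-trans f g

finite-× : ∀ {A B} → Finite A → Finite B → Finite (A × B)
finite-× (m , f) (n , g) = m * n , ↔-trans (f ×-↔ g) (↔-sym *↔×)

finite-⊎ : ∀ {A B} → Finite A → Finite B → Finite (A ⊎ B)
finite-⊎ (m , f) (n , g) = m + n , ↔-trans (f ⊎-↔ g) (↔-sym +↔⊎)

finite-Bool : Finite Bool
finite-Bool = 2 , ↔-sym 2↔Bool

Maybe↔⊎ : ∀ {A : Set} → Maybe A ↔ (Fin 1 ⊎ A)
Maybe↔⊎ = mk↔ₛ′
  (λ { nothing → inj₁ fzero ; (just a) → inj₂ a })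
  (λ { (inj₁ fzero) → nothing ; (inj₂ a) → just a })
  (λ { (inj₁ fzero) → refl ; (inj₂ _) → refl })
  (λ { nothing → refl ; (just _) → refl })

finite-Symbol : Finite Symbol
finite-Symbol = finite-↔ Maybe↔⊎ (finite-⊎ (1 , ↔-refl) (finite-× finite-Bool finite-Bool))

State↔ : State ↔ (Fin 3 ⊎ (Bool ⊎ Bool) ⊎ (Bool × Bool × Bool))
State↔ = mk↔ₛ′
  (λ { swap → inj₁ fzero ; verify → inj₁ (fsuc fzero) ; accept → inj₁ (fsuc (fsuc fzero))
     ; (idle f) → inj₂ (inj₁ (inj₁ f)) ; (back f) → inj₂ (inj₁ (inj₂ f))
     ; (add β κ f) → inj₂ (inj₂ (β , κ , f)) })
  (λ { (inj₁ fzero) → swap ; (inj₁ (fsuc fzero)) → verify ; (inj₁ (fsuc (fsuc fzero))) → accept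
     ; (inj₂ (inj₁ (inj₁ f))) → idle f ; (inj₂ (inj₁ (inj₂ f))) → back f
     ; (inj₂ (inj₂ (β , κ , f))) → add β κ f })
  (λ { (inj₁ fzero) → refl ; (inj₁ (fsuc fzero)) → refl ; (inj₁ (fsuc (fsuc fzero))) → refl
     ; (inj₂ (inj₁ (inj₁ _))) → refl ; (inj₂ (inj₁ (inj₂ _))) → refl ; (inj₂ (inj₂ _)) → refl })
  (λ { swap → refl ; verify → refl ; accept → refl
     ; (idle _) → refl ; (back _) → refl ; (add _ _ _) → refl })

finite-State : Finite State
finite-State = finite-↔ State↔
  (finite-⊎ (3 , ↔-refl)
    (finite-⊎ (finite-⊎ finite-Bool finite-Bool)
      (finite-× finite-Bool (finite-× finite-Bool finite-Bool))))

-- The start state performs an empty sweep; it leaves the two blank cells that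
-- delimit an empty list of digits.
counter : NTM
counter = record
  { State = State ; Symbol = Symbol
  ; finite-State = finite-State ; finite-Symbol = finite-Symbol
  ; tapes = 1 ; start = add false false loading ; accepting = isAccept ; blank = nothing
  ; δ = transitions ; δ-unique = transitions-unique }

-- The work tape

⟦_⟧ : Bool → ℕ
⟦ b ⟧ = if b then 1 else 0

-- The number whose bits, least significant first, are selected by p.
value : (Digit → Bool) → List Digit → ℕ
value p []       = 0
value p (d ∷ ds) = ⟦ p d ⟧ + 2 * value p ds

-- The numbers c and d.
pending passed : List Digit → ℕ
pending = value proj₁
passed  = value proj₂

-- One digit of a subtraction and of an addition: v and v′ are the values of the
-- more significant digits before and after the operation.
borrow-digit : ∀ β x {v v′} → ⟦ β ∧ not x ⟧ + v′ ≡ v →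
  ⟦ β ⟧ + (⟦ β xor x ⟧ + 2 * v′) ≡ ⟦ x ⟧ + 2 * v
borrow-digit false x               refl = refl
borrow-digit true  true            refl = refl
borrow-digit true  false {v′ = v′} refl = sym (*-suc 2 v′)

carry-digit : ∀ κ y {v v′} → v′ ≡ ⟦ κ ∧ y ⟧ + v →
  ⟦ κ xor y ⟧ + 2 * v′ ≡ ⟦ κ ⟧ + (⟦ y ⟧ + 2 * v)
carry-digit false y             refl = refl
carry-digit true  false         refl = refl
carry-digit true  true  {v = v} refl = *-suc 2 v

borrow-≤ : ∀ β x v → ⟦ β ⟧ ≤ ⟦ x ⟧ + 2 * v → ⟦ β ∧ not x ⟧ ≤ v
borrow-≤ false x     v       _ = z≤n
borrow-≤ true  true  v       _ = z≤n
borrow-≤ true  false (suc v) _ = s≤s z≤n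

carry-≤ : ∀ κ y v → 2 * (⟦ κ ∧ y ⟧ + v) ≤ ⟦ κ ⟧ + (⟦ y ⟧ + 2 * v)
carry-≤ false y     v = m≤n+m (2 * v) ⟦ y ⟧
carry-≤ true  false v = n≤1+n (2 * v)
carry-≤ true  true  v = ≤-reflexive (*-suc 2 v)

-- Digits and the blank cell beyond the last of them: the cell where a sweep turns
-- round, or the resting cell if the digits are listed backwards.
cells : List Digit → List Symbol
cells ds = map just ds ++ [ nothing ]

-- The tape during a sweep.  The digits pre, nearest first, lie to the left of
-- those in ds.  In scanning pre ds the head is on the first digit of ds, or on
-- the blank behind the digits; in returning pre ds it is on the first digit of
-- pre, or on the resting cell.
scanning returning : List Digit → List Digit → Tape Symbol
scanning pre []       = tape (cells pre) nothing []
scanning pre (d ∷ ds) = tape (cells pre) (just d) (cells ds)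

returning []        ds = tape [] nothing (cells ds)
returning (p ∷ pre) ds = tape (cells pre) (just p) (cells ds)

length-cells : ∀ ds → length (cells ds) ≡ suc (length ds)
length-cells []       = refl
length-cells (_ ∷ ds) = cong suc (length-cells ds)

size-scanning : ∀ pre ds → size (scanning pre ds) ≡ 2 + (length pre + length ds)
size-scanning pre []       = cong (λ l → suc (l + 0)) (length-cells pre)
size-scanning pre (_ ∷ ds) = cong₂ (λ l r → suc (l + r)) (length-cells pre) (length-cells ds)

size-returning : ∀ pre ds → size (returning pre ds) ≡ 2 + (length pre + length ds)
size-returning []        ds = cong suc (length-cells ds)
size-returning (_ ∷ pre) ds =
  trans (cong₂ (λ l r → suc (l + r)) (length-cells pre) (length-cells ds))
        (cong (2 +_) (+-suc (length pre) (length ds)))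

launch-right : ∀ ds → writeShift nothing (nothing , right) (returning [] ds) ≡ scanning [] ds
launch-right []      = refl
launch-right (_ ∷ _) = refl

scan-right : ∀ d′ pre d ds →
  writeShift nothing (just d′ , right) (scanning pre (d ∷ ds)) ≡ scanning (d′ ∷ pre) ds
scan-right d′ pre d []      = refl
scan-right d′ pre d (_ ∷ _) = refl

turn-left : ∀ pre → writeShift nothing (nothing , left) (scanning pre []) ≡ returning pre []
turn-left []      = refl
turn-left (_ ∷ _) = refl

return-left : ∀ p pre ds →
  writeShift nothing (just p , left) (returning (p ∷ pre) ds) ≡ returning pre (p ∷ ds)
return-left p []      ds = refl
return-left p (_ ∷ _) ds = refl

-- The input tape

-- The scanned input cell for a given unread part of the input.
inputCell : List Bool → InputCell
inputCell []      = rightEnd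
inputCell (b ∷ _) = bit b

readInput-drop : ∀ x i → readInput x (suc i) ≡ inputCell (drop i x)
readInput-drop []      zero    = refl
readInput-drop []      (suc i) = refl
readInput-drop (b ∷ x) zero    = refl
readInput-drop (b ∷ x) (suc i) = readInput-drop x i

drop-suc : ∀ (x : List Bool) i {b y} → drop i x ≡ b ∷ y → drop (suc i) x ≡ y
drop-suc (_ ∷ x) zero    refl = refl
drop-suc (_ ∷ x) (suc i) eq   = drop-suc x i eq

moveInput-right : ∀ x i {b y} → drop i x ≡ b ∷ y → moveInput x right (suc i) ≡ suc (suc i)
moveInput-right (_ ∷ x) zero    _  = refl
moveInput-right (_ ∷ x) (suc i) eq = cong suc (moveInput-right x i eq)

-- Assembling the computation tree

isZero-double : ∀ m n → isZero (2 * m + 2 * n) ≡ isZero (m + n)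
isZero-double m n = trans (cong isZero (sym (*-distribˡ-+ 2 m n))) (double (m + n))
  where
  double : ∀ k → isZero (2 * k) ≡ isZero k
  double zero    = refl
  double (suc _) = refl

module _ (x : List Bool) where

  L : ℕ
  L = ⌊log₂ length x ⌋

  open Run counter x
  open ComputationTree counter x (3 + L)

  -- The configuration with the given single work tape.
  on : State → ℕ → Tape Symbol → Config
  on q i t = config q i (t ∷ [])

  -- The configurations between two operations.
  resting : Phase → ℕ → List Digit → Config
  resting f i ds = on (idle f) i (returning [] ds)

  -- At most L + 1 digits; the two delimiting blanks bring the space to L + 3.
  Fits : List Digit → List Digit → Set
  Fits pre ds = length pre + length ds ≤ suc L

  fits-shift : ∀ (pre ds : List Digit) →
    length pre + suc (length ds) ≤ suc L → suc (length pre + length ds) ≤ suc L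
  fits-shift pre ds = subst (_≤ suc L) (+-suc (length pre) (length ds))

  fits-unshift : ∀ (pre ds : List Digit) →
    suc (length pre + length ds) ≤ suc L → length pre + suc (length ds) ≤ suc L
  fits-unshift pre ds = subst (_≤ suc L) (sym (+-suc (length pre) (length ds)))

  space-≤ : ∀ (t : Tape Symbol) {n} → size t ≡ 2 + n → n ≤ suc L → size t + 0 ≤ 3 + L
  space-≤ t eq n≤ = ≤-trans (≤-reflexive (trans (+-identityʳ (size t)) eq)) (s≤s (s≤s n≤))

  scanning-≤ : ∀ pre ds → Fits pre ds → size (scanning pre ds) + 0 ≤ 3 + L
  scanning-≤ pre ds = space-≤ (scanning pre ds) (size-scanning pre ds)

  returning-≤ : ∀ pre ds → Fits pre ds → size (returning pre ds) + 0 ≤ 3 + L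
  returning-≤ pre ds = space-≤ (returning pre ds) (size-returning pre ds)

  -- Since pre is listed backwards, pre ʳ++ ds are all digits in their order.
  rewind : ∀ f i pre ds {k} → Fits pre ds →
    Tree (resting f i (pre ʳ++ ds)) k → Tree (on (back f) i (returning pre ds)) k
  rewind f i []        ds fits t = one (returning-≤ [] ds fits) refl refl t
  rewind f i (p ∷ pre) ds fits t =
    one (returning-≤ (p ∷ pre) ds fits) refl (cong (on (back f) i) (return-left p pre ds))
      (rewind f i pre (p ∷ ds) (fits-unshift pre ds fits) t)

  add-turn : ∀ f i pre {k} → Fits pre [] →
    Tree (resting f i (pre ʳ++ [])) k → Tree (on (add false false f) i (scanning pre [])) k
  add-turn f i pre fits t =
    one (scanning-≤ pre [] fits) refl (cong (on (back f) i) (turn-left pre)) (rewind f i pre [] fits t)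

  -- The room hypothesis says that the digits in ds, which have weight
  -- 2 ^ length pre and above, do not bring d above |x|.  If the carry reaches the
  -- end, it gives 2 ^ length pre ≤ |x|, so that a further digit still fits.
  add-sweep : ∀ f i β κ pre ds {k} → Fits pre ds →
    ⟦ β ⟧ ≤ pending ds →
    2 ^ length pre * (⟦ κ ⟧ + passed ds) ≤ length x →
    (∀ ds′ → ⟦ β ⟧ + pending ds′ ≡ pending ds → passed ds′ ≡ ⟦ κ ⟧ + passed ds → Fits pre ds′ →
      Tree (resting f i (pre ʳ++ ds′)) k) →
    Tree (on (add β κ f) i (scanning pre ds)) k
  add-sweep f i false false pre [] fits _ _ next = add-turn f i pre fits (next [] refl refl fits)
  add-sweep f i false true  pre [] {k} fits _ room next =
    one (scanning-≤ pre [] fits) refl refl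
      (add-turn f i (d ∷ pre) (fits-shift pre [] fits′) (next [ d ] refl refl fits′))
    where
    d : Digit
    d = false , true
    pre≤L : length pre ≤ L
    pre≤L = subst (_≤ L) (⌊log₂[2^n]⌋≡n (length pre))
              (⌊log₂⌋-mono-≤ (subst (_≤ length x) (*-identityʳ (2 ^ length pre)) room))
    fits′ : Fits pre [ d ]
    fits′ = subst (_≤ suc L) (+-comm 1 (length pre)) (s≤s pre≤L)
  add-sweep f i β κ pre (d@(a , b) ∷ ds) fits β≤ room next =
    one (scanning-≤ pre (d ∷ ds) fits) refl (cong (on _ i) (scan-right d′ pre d ds))
      (add-sweep f i (β ∧ not a) (κ ∧ b) (d′ ∷ pre) ds
        (fits-shift pre ds fits)
        (borrow-≤ β a (pending ds) β≤)
        room′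
        (λ ds′ pd ps fits′ → next (d′ ∷ ds′) (borrow-digit β a pd) (carry-digit κ b ps)
                               (fits-unshift pre ds′ fits′)))
    where
    d′ : Digit
    d′ = β xor a , κ xor b
    room′ : 2 ^ suc (length pre) * (⟦ κ ∧ b ⟧ + passed ds) ≤ length x
    room′ = begin
      2 ^ suc (length pre) * (⟦ κ ∧ b ⟧ + passed ds)
        ≡⟨ cong (_* (⟦ κ ∧ b ⟧ + passed ds)) (*-comm 2 (2 ^ length pre)) ⟩
      2 ^ length pre * 2 * (⟦ κ ∧ b ⟧ + passed ds)
        ≡⟨ *-assoc (2 ^ length pre) 2 _ ⟩
      2 ^ length pre * (2 * (⟦ κ ∧ b ⟧ + passed ds))
        ≤⟨ *-monoʳ-≤ (2 ^ length pre) (carry-≤ κ b (passed ds)) ⟩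
      2 ^ length pre * (⟦ κ ⟧ + passed (d ∷ ds))
        ≤⟨ room ⟩
      length x ∎
      where open ≤-Reasoning

  underflow : ∀ f i κ pre ds → Fits pre ds → pending ds ≡ 0 →
    Tree (on (add true κ f) i (scanning pre ds)) 0
  underflow f i κ pre []                    fits _  = dead-end (scanning-≤ pre [] fits) refl refl
  underflow f i κ pre (d@(false , b) ∷ ds) fits eq =
    one (scanning-≤ pre (d ∷ ds) fits) refl (cong (on _ i) (scan-right d′ pre d ds))
      (underflow f i (κ ∧ b) (d′ ∷ pre) ds (fits-shift pre ds fits)
        (m+n≡0⇒m≡0 (pending ds) eq))
    where
    d′ : Digit
    d′ = true , κ xor b

  swap-sweep : ∀ i pre ds {k} → Fits pre ds → pending ds ≡ 0 →
    (∀ ds′ → pending ds′ ≡ passed ds → passed ds′ ≡ 0 → Fits pre ds′ →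
      Tree (resting choosing i (pre ʳ++ ds′)) k) →
    Tree (on swap i (scanning pre ds)) k
  swap-sweep i pre [] fits _ next =
    one (scanning-≤ pre [] fits) refl (cong (on _ i) (turn-left pre))
      (rewind choosing i pre [] fits (next [] refl refl fits))
  swap-sweep i pre (d@(false , b) ∷ ds) fits eq next =
    one (scanning-≤ pre (d ∷ ds) fits) refl (cong (on _ i) (scan-right d′ pre d ds))
      (swap-sweep i (d′ ∷ pre) ds (fits-shift pre ds fits)
        (m+n≡0⇒m≡0 (pending ds) eq)
        (λ ds′ pd ps fits′ → next (d′ ∷ ds′) (cong (λ v → ⟦ b ⟧ + 2 * v) pd) (cong (2 *_) ps)
                               (fits-unshift pre ds′ fits′)))
    where
    d′ : Digit
    d′ = b , false

  swap-refused : ∀ i pre ds → Fits pre ds → pending ds ≢ 0 →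
    Tree (on swap i (scanning pre ds)) 0
  swap-refused i pre []                   fits ≢0 = ⊥-elim (≢0 refl)
  swap-refused i pre (d@(true  , b) ∷ ds) fits ≢0 = dead-end (scanning-≤ pre (d ∷ ds) fits) refl refl
  swap-refused i pre (d@(false , b) ∷ ds) fits ≢0 =
    one (scanning-≤ pre (d ∷ ds) fits) refl (cong (on _ i) (scan-right d′ pre d ds))
      (swap-refused i (d′ ∷ pre) ds (fits-shift pre ds fits)
        (≢0 ∘ cong (2 *_)))
    where
    d′ : Digit
    d′ = b , false

  verify-sweep : ∀ i pre ds → Fits pre ds →
    Tree (on verify i (scanning pre ds)) (isZero (pending ds + passed ds))
  verify-sweep i pre [] fits =
    one (scanning-≤ pre [] fits) refl refl (leaf (scanning-≤ pre [] fits) refl)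
  verify-sweep i pre (d@(true , b) ∷ ds) fits = dead-end (scanning-≤ pre (d ∷ ds) fits) refl refl
  verify-sweep i pre (d@(false , true) ∷ ds) fits =
    subst (Tree _) (sym (cong isZero (+-suc (2 * pending ds) (2 * passed ds))))
      (dead-end (scanning-≤ pre (d ∷ ds) fits) refl refl)
  verify-sweep i pre (d@(false , false) ∷ ds) fits =
    subst (Tree _) (sym (isZero-double (pending ds) (passed ds)))
      (one (scanning-≤ pre (d ∷ ds) fits) refl (cong (on _ i) (scan-right d pre d ds))
        (verify-sweep i (d ∷ pre) ds (fits-shift pre ds fits)))

  -- The digits ds hold the numbers c and d.
  record Represents (ds : List Digit) (c d : ℕ) : Set where
    constructor represents
    field
      pending≡ : pending ds ≡ c
      passed≡  : passed ds ≡ d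
      width≤   : length ds ≤ suc L

  -- Subtract β from c and add κ to d, starting from the resting cell; likewise
  -- exchange below.
  update : ∀ f i β κ {ds c d k} → Represents ds (⟦ β ⟧ + c) d → ⟦ κ ⟧ + d ≤ length x →
    (∀ ds′ → Represents ds′ c (⟦ κ ⟧ + d) → Tree (resting f i ds′) k) →
    Tree (on (add β κ f) i (scanning [] ds)) k
  update f i β κ {ds} {c} {d} (represents pd refl w) room next =
    add-sweep f i β κ [] ds w (subst (⟦ β ⟧ ≤_) (sym pd) (m≤m+n ⟦ β ⟧ c))
      (subst (_≤ length x) (sym (*-identityˡ (⟦ κ ⟧ + d))) room)
      (λ ds′ pd′ ps′ w′ → next ds′ (represents (+-cancelˡ-≡ ⟦ β ⟧ _ _ (trans pd′ pd)) ps′ w′))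

  exchange : ∀ i {ds d k} → Represents ds 0 d →
    (∀ ds′ → Represents ds′ d 0 → Tree (resting choosing i ds′) k) →
    Tree (on swap i (scanning [] ds)) k
  exchange i {ds} (represents pd refl w) next =
    swap-sweep i [] ds w pd (λ ds′ pd′ ps′ w′ → next ds′ (represents pd′ ps′ w′))

  launched-stay : ∀ q i ds →
    apply (launch q stay) (resting choosing (suc i) ds) ≡ on q (suc i) (scanning [] ds)
  launched-stay q i ds = cong (on q (suc i)) (launch-right ds)

  launched-right : ∀ f q i ds {b y} → drop i x ≡ b ∷ y →
    apply (launch q right) (resting f (suc i) ds) ≡ on q (suc (suc i)) (scanning [] ds)
  launched-right f q i ds eq = cong₂ (on q) (moveInput-right x i eq) (launch-right ds)

  resting-moves : ∀ f i ds {y} → drop i x ≡ y → moves (resting f (suc i) ds) ≡ choices f (inputCell y)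
  resting-moves f i ds eq = cong (choices f) (trans (readInput-drop x i) (cong inputCell eq))

  -- Every recursive call of ways keeps c + d at most |x|, as the additions to d
  -- require.  Whenever the machine tries a step that c does not permit, the
  -- branch dies within the sweep and contributes 0.
  choosing-tree : ∀ y i c d ds → drop i x ≡ y → c + d ≤ length x → Represents ds c d →
    Tree (resting choosing (suc i) ds) (ways y c d)
  choosing-tree [] i c d ds eq _ (represents refl refl w) =
    one (returning-≤ [] ds w) (resting-moves choosing i ds eq) (launched-stay verify i ds)
      (verify-sweep (suc i) [] ds w)
  choosing-tree (false ∷ y) i zero d ds eq room r@(represents pd _ w) =
    subst (Tree _) (+-identityʳ (ways y d 0))
      (two (returning-≤ [] ds w) (resting-moves choosing i ds eq)
        (launched-right choosing swap i ds eq) (launched-stay _ i ds)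
        (exchange (suc (suc i)) r λ ds′ →
          choosing-tree y (suc i) d 0 ds′ (drop-suc x i eq)
            (subst (_≤ length x) (sym (+-identityʳ d)) room))
        (underflow choosing (suc i) true [] ds w pd))
  choosing-tree (false ∷ y) i (suc c) d ds eq room r@(represents pd _ w) =
    two (returning-≤ [] ds w) (resting-moves choosing i ds eq)
      (launched-right choosing swap i ds eq) (launched-stay _ i ds)
      (swap-refused (suc (suc i)) [] ds w (1+n≢0 ∘ trans (sym pd)))
      (update choosing (suc i) true true r (≤-trans (s≤s (m≤n+m d c)) room) λ ds′ →
        choosing-tree (false ∷ y) i c (suc d) ds′ eq (subst (_≤ length x) (sym (+-suc c d)) room))
  choosing-tree (true ∷ y) i zero d ds eq room (represents pd _ w) =
    two (returning-≤ [] ds w) (resting-moves choosing i ds eq)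
      (launched-right choosing _ i ds eq) (launched-stay _ i ds)
      (underflow choosing (suc (suc i)) false [] ds w pd)
      (underflow choosing (suc i) true [] ds w pd)
  choosing-tree (true ∷ y) i (suc c) d ds eq room r@(represents pd _ w) =
    two (returning-≤ [] ds w) (resting-moves choosing i ds eq)
      (launched-right choosing _ i ds eq) (launched-stay _ i ds)
      (update choosing (suc (suc i)) true false r (≤-trans (m≤n+m d (suc c)) room) λ ds′ →
        choosing-tree y (suc i) c d ds′ (drop-suc x i eq) (≤-trans (n≤1+n (c + d)) room))
      (update choosing (suc i) true true r (≤-trans (s≤s (m≤n+m d c)) room) λ ds′ →
        choosing-tree (true ∷ y) i c (suc d) ds′ eq (subst (_≤ length x) (sym (+-suc c d)) room))

  loading-tree : ∀ y i d ds → drop i x ≡ y → d + length y ≤ length x → Represents ds 0 d →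
    Tree (resting loading (suc i) ds) (total y d)
  loading-tree [] i d ds eq _ (represents _ _ w) =
    dead-end (returning-≤ [] ds w) (resting-moves loading i ds eq) refl
  loading-tree (true ∷ y) i d ds eq room r =
    one (returning-≤ [] ds (Represents.width≤ r)) (resting-moves loading i ds eq)
      (launched-right loading _ i ds eq)
      (update loading (suc (suc i)) false true r (≤-trans (m≤m+n (suc d) (length y)) room′) λ ds′ →
        loading-tree y (suc i) (suc d) ds′ (drop-suc x i eq) room′)
    where
    room′ : suc d + length y ≤ length x
    room′ = subst (_≤ length x) (+-suc d (length y)) room
  loading-tree (false ∷ y) i d ds eq room r =
    one (returning-≤ [] ds (Represents.width≤ r)) (resting-moves loading i ds eq)
      (launched-right loading _ i ds eq)
      (exchange (suc (suc i)) r λ ds′ →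
        choosing-tree y (suc i) d 0 ds′ (drop-suc x i eq) (≤-trans (+-monoʳ-≤ d z≤n) room))

  initial-tree : Tree initial (total x 0)
  initial-tree =
    one (s≤s z≤n) refl refl
      (rewind loading 0 [] [] z≤n
        (one (returning-≤ [] [] z≤n) refl refl
          (loading-tree x 0 0 [] refl ≤-refl (represents refl refl z≤n))))

-- For n ≥ 2 the logarithm is at least 1, which absorbs the constant.
3+log≤4*log : ∀ n → 2 ≤ n → 3 + ⌊log₂ n ⌋ ≤ 4 * ⌊log₂ n ⌋
3+log≤4*log n 2≤n = begin
  3 + l     ≤⟨ +-monoˡ-≤ l (*-monoʳ-≤ 3 (⌊log₂⌋-mono-≤ 2≤n)) ⟩
  3 * l + l ≡⟨ +-comm (3 * l) l ⟩
  4 * l     ∎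
  where
  open ≤-Reasoning
  l = ⌊log₂ n ⌋

theorem3p2 : multinomialFunction ∈#L
theorem3p2 = counter , halts , (4 , 2 , logSpace) , counts
  where
  halts : ∀ x → Run.HaltsOnEveryPath counter x
  halts x = ComputationTree.tree-acc counter x _ (initial-tree x)
  logSpace : ∀ x → 2 ≤ length x → ∀ D → Star (Run._⟶_ counter x) (Run.initial counter x) D →
    Run.space counter x D ≤ 4 * ⌊log₂ length x ⌋
  logSpace x 2≤n D path =
    ≤-trans (ComputationTree.tree-space counter x _ (initial-tree x) path) (3+log≤4*log (length x) 2≤n)
  counts : ∀ x → Run.AcceptingPath counter x ↔ Fin (multinomialFunction x)
  counts x = subst (λ k → Run.AcceptingPath counter x ↔ Fin k) (total≡multinomialValue x 0)
    (ComputationTree.tree-count counter x _ (initial-tree x))
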